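{- Let $K_1$ and $K_2$ be two complete graphs on $n_1\ge 1$ and $n_2\ge 1$ vertices, respectively. Let $G$ be a bridge sum of $K_1$ and $K_2$ (at any vertex of $K_1$ and any vertex of $K_2$). Then all orbits of toric promotion on $G$ have length $(n_1+n_2)(n_1+n_2-1)$.
   Context: Toric promotion. Let $G=(V,E)$ be a finite simple graph (undirected, no loops, no multiple edges) on $N$ vertices. A labeling of $G$ is a bijection $\sigma:V\to\mathbb{Z}/N\mathbb{Z}=\{1,\dots,N\}$ (addition modulo $N$). A state is a pair $(\sigma,i)$ with $\sigma$ a labeling of $G$ and $i\in\mathbb{Z}/N\mathbb{Z}$; $\Omega_G$ is the set of all states. Toric promotion is the map $\mathrm{TPro}:\Omega_G\to\Omega_G$ given by $\mathrm{TPro}(\sigma,i)=(\sigma,i+1)$ if $\{\sigma^{ -1}(i),\sigma^{ -1}(i+1)\}\in E$, and $\mathrm{TPro}(\sigma,i)=((i,i+1)\circ\sigma,\,i+1)$ otherwise, where $(i,i+1)$ is the permutation of $\mathbb{Z}/N\mathbb{Z}$ swapping $i$ and $i+1$. It is a bijection of $\Omega_G$. The length of the orbit containing $(\sigma,i)$ is the least $L\ge 1$ with $\mathrm{TPro}^L(\sigma,i)=(\sigma,i)$. Bridge sum. For graphs $G_1=(V_1,E_1)$, $G_2=(V_2,E_2)$ with disjoint vertex sets and vertices $v_1\in V_1$, $v_2\in V_2$, the bridge sum of $G_1$ and $G_2$ at $v_1$ and $v_2$ is the graph with vertex set $V_1\cup V_2$ and edge set $E_1\cup E_2\cup\{\{v_1,v_2\}\}$.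 -}

module Defs where

open import Data.Fin using (Fin; toℕ)
open import Data.Fin.Permutation using (transpose)
open import Data.Fin.Properties using (inj⇒≟; nonZeroIndex; +↔⊎)
open import Data.Nat using (ℕ; suc; _+_; _≤_)
open import Data.Nat.DivMod using (_mod_)
open import Data.Product using (_×_; _,_)
open import Data.Sum using (_⊎_; inj₁; inj₂)
open import Data.Sum.Function.Propositional using (_⊎-↔_)
open import Function.Bundles using (_↔_; Inverse)
open import Function.Construct.Composition using (_↔-∘_)
open import Function.Construct.Symmetry using (↔-sym)
import Function.Endo.Propositional as Endo
open import Function.Properties.Inverse using (↔⇒↣)
open import Relation.Binary using (Decidable; DecidableEquality; Irreflexive; Symmetric)
open import Relation.Binary.PropositionalEquality using (_≡_; _≢_; _≗_; refl)
open import Relation.Nullary using (yes; no)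
open import Relation.Nullary.Decidable using (map′; _×-dec_)

-- A finite simple graph on n vertices.  An undirected edge {u , v} is
-- encoded by a symmetric irreflexive relation; it is required to be
-- decidable because toric promotion branches on adjacency.
record Graph (n : ℕ) : Set₁ where
  infix 4 _~_ _~?_
  field
    V           : Set
    enumeration : V ↔ Fin n
    _~_         : V → V → Set
    _~?_        : Decidable _~_
    ~-sym       : Symmetric _~_
    ~-irrefl    : Irreflexive _≡_ _~_

  _≟_ : DecidableEquality V
  _≟_ = inj⇒≟ (↔⇒↣ enumeration)

open Graph using (V)

IsComplete : ∀ {n} → Graph n → Set
IsComplete G = ∀ u v → u ≢ v → u ~ v
  where open Graph G using (_~_)

module _ {m n : ℕ} (G : Graph m) (H : Graph n) (a : V G) (b : V H) where

  private
    module G = Graph G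
    module H = Graph H

  data BridgeEdge : G.V ⊎ H.V → G.V ⊎ H.V → Set where
    left    : ∀ {u v} → u G.~ v → BridgeEdge (inj₁ u) (inj₁ v)
    right   : ∀ {u v} → u H.~ v → BridgeEdge (inj₂ u) (inj₂ v)
    bridge  : BridgeEdge (inj₁ a) (inj₂ b)
    bridge′ : BridgeEdge (inj₂ b) (inj₁ a)

  bridgeEdge? : Decidable BridgeEdge
  bridgeEdge? (inj₁ u) (inj₁ v) = map′ left  (λ { (left e)  → e }) (u G.~? v)
  bridgeEdge? (inj₂ u) (inj₂ v) = map′ right (λ { (right e) → e }) (u H.~? v)
  bridgeEdge? (inj₁ u) (inj₂ v) =
    map′ (λ { (refl , refl) → bridge }) (λ { bridge → refl , refl })
         ((u G.≟ a) ×-dec (v H.≟ b))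
  bridgeEdge? (inj₂ u) (inj₁ v) =
    map′ (λ { (refl , refl) → bridge′ }) (λ { bridge′ → refl , refl })
         ((u H.≟ b) ×-dec (v G.≟ a))

  bridgeSum : Graph (m + n)
  bridgeSum = record
    { V           = G.V ⊎ H.V
    ; enumeration = ↔-sym +↔⊎ ↔-∘ (G.enumeration ⊎-↔ H.enumeration)
    ; _~_         = BridgeEdge
    ; _~?_        = bridgeEdge?
    ; ~-sym       = λ { (left e)  → left (G.~-sym e)
                      ; (right e) → right (H.~-sym e)
                      ; bridge    → bridge′
                      ; bridge′   → bridge }
    ; ~-irrefl    = λ { refl (left e)  → G.~-irrefl refl e
                      ; refl (right e) → H.~-irrefl refl e }
    }

-- Fin n stands for ℤ/nℤ, with residues 0 , … , n - 1 (so the label n is 0).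
next : ∀ {n} → Fin n → Fin n
next {n} i = (suc (toℕ i) mod n) {{nonZeroIndex i}}

module _ {n : ℕ} (G : Graph n) where

  open Graph G using (_~?_)

  Labeling : Set
  Labeling = V G ↔ Fin n

  State : Set
  State = Labeling × Fin n

  -- Labelings are compared as functions: propositional equality of the
  -- records would also compare the proofs that they are bijections.
  _≈ₛ_ : State → State → Set
  (σ , i) ≈ₛ (τ , j) = (Inverse.to σ ≗ Inverse.to τ) × i ≡ j

  TPro : State → State
  TPro (σ , i) with Inverse.from σ i ~? Inverse.from σ (next i)
  ... | yes _ = σ , next i
  ... | no  _ = transpose i (next i) ↔-∘ σ , next i

  open Endo State using (_^_)

  Returns : State → ℕ → Set
  Returns s k = (TPro ^ k) s ≈ₛ s

  OrbitHasLength : State → ℕ → Set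
  OrbitHasLength s ℓ =
    (1 ≤ ℓ × Returns s ℓ) × (∀ k → 1 ≤ k → Returns s k → ℓ ≤ k)

{-# OPTIONS --safe #-}
module Submission where

-- List the vertices of a state (σ , i) as σ⁻¹(i), σ⁻¹(i+1), … .  In these terms
-- a step compares the carried vertex (the head) with the next one: the carried
-- vertex is exchanged with it if they are adjacent and carried past it otherwise,
-- and the vertex left behind joins the back of the queue.  While the carried
-- vertex is in one clique, the other clique stays put, and every round of N - 1
-- steps turns the first clique by one place, until its bridge vertex is carried
-- up to the other bridge vertex and the cliques change roles.  Between such
-- meetings a clique of size n makes n rounds, a full turn that restores its
-- arrangement; so the list at which v₁ meets v₂ first recurs, unchanged, after
-- (n₁ + n₂)(N - 1) steps, a multiple of N.  As every orbit contains such a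
-- meeting and steps are injective, this is the length of every orbit.

open import Defs
open import Data.Fin as Fin using (Fin; toℕ)
import Data.Fin.Permutation.Components as Components
open import Data.Fin.Properties using (toℕ-fromℕ<; toℕ-injective; toℕ<n; nonZeroIndex)
open import Data.List
  using (List; []; _∷_; [_]; _++_; _∷ʳ_; _∷ʳ′_; applyUpTo; drop; initLast; length; map; mapMaybe)
open import Data.List.Membership.Propositional using (_∈_)
import Data.List.Membership.DecPropositional as DecMembership
open import Data.List.Membership.Propositional.Properties using (∈-∃++; ∈-map⁺; ∈-applyUpTo⁺)
open import Data.List.Properties
  using (++-assoc; ++-identityʳ; ∷-injective; ∷ʳ-injective; length-map; length-++; map-cong;
         map-cong-local; map-++; length-applyUpTo; applyUpTo-∷ʳ)
open import Data.List.Relation.Binary.Permutation.Propositional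
  using (_↭_; ↭-refl; ↭-trans; ↭-swap; prep; ↭⇒↭ₛ)
open import Data.List.Relation.Binary.Permutation.Propositional.Properties
  using (∷↭∷ʳ; ↭-length; ∈-resp-↭)
import Data.List.Relation.Binary.Permutation.Setoid.Properties as SetoidPermutation
open import Data.List.Relation.Unary.All as All using (All; []; _∷_)
import Data.List.Relation.Unary.All.Properties as All
open import Data.List.Relation.Unary.AllPairs as AllPairs using ([]; _∷_)
open import Data.List.Relation.Unary.Any using (here; there)
open import Data.List.Relation.Unary.Unique.Propositional using (Unique)
open import Data.List.Relation.Unary.Unique.Propositional.Properties using (map⁺; applyUpTo⁺₁)
open import Data.Maybe using (Maybe; just; nothing)
open import Data.Nat
  using (ℕ; zero; suc; NonZero; _+_; _*_; _∸_; _≤_; _<_; z≤n; s≤s; s<s)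
open import Data.Nat.DivMod
  using (_%_; _mod_; %-distribˡ-+; m%n%n≡m%n; m%n<n; m<n⇒m%n≡m; [m+n]%n≡m%n; [m+kn]%n≡m%n)
open import Data.Nat.Properties
  using (+-assoc; +-comm; +-suc; +-identityʳ; +-mono-≤; *-comm; *-distribʳ-+; m∸n+n≡m;
         m+[n∸m]≡n; ≮⇒≥; <⇒≤; <⇒≢; <-trans; suc-injective)
open import Data.Product using (_×_; _,_; ∃-syntax; ∃₂; proj₁; proj₂)
open import Data.Sum using (_⊎_; inj₁; inj₂; [_,_]′; isInj₁; isInj₂; swap)
open import Data.Sum.Properties using (inj₁-injective; inj₂-injective)
open import Function using (_∘_; _∋_; id)
open import Function.Bundles using (Inverse; Injection)
open import Function.Construct.Symmetry using (↔-sym)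
import Function.Endo.Propositional as Endo
open import Function.Properties.Inverse using (↔⇒↣)
open import Relation.Binary using (Decidable; DecidableEquality; Symmetric)
open import Relation.Binary.PropositionalEquality
  using (_≡_; _≢_; _≗_; refl; sym; trans; setoid; cong; cong₂; subst; subst₂; module ≡-Reasoning)
open import Relation.Nullary using (¬_; yes; no; contradiction)
open import Relation.Nullary.Decidable using (dec-true; dec-false)

Unique-resp-↭ : ∀ {A : Set} {xs ys : List A} → xs ↭ ys → Unique xs → Unique ys
Unique-resp-↭ {A} p = SetoidPermutation.Unique-resp-↭ (setoid A) (↭⇒↭ₛ p)

-- Iterates of a map, and runs along which a property holds.

module Iteration {A : Set} (f : A → A) where

  open Endo A public using (_^_; ^-homo)

  ^-sucʳ : ∀ n x → (f ^ suc n) x ≡ (f ^ n) (f x)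
  ^-sucʳ zero    x = refl
  ^-sucʳ (suc n) x = cong f (^-sucʳ n x)

  ^-+ : ∀ m n x → (f ^ (m + n)) x ≡ (f ^ m) ((f ^ n) x)
  ^-+ m n x = cong (λ g → g x) (^-homo f m n)

  ^-comm : ∀ m n x → (f ^ m) ((f ^ n) x) ≡ (f ^ n) ((f ^ m) x)
  ^-comm m n x = trans (sym (^-+ m n x)) (trans (cong (λ k → (f ^ k) x) (+-comm m n)) (^-+ n m x))

  ^-trans : ∀ n m {x y z} → (f ^ m) x ≡ y → (f ^ n) y ≡ z → (f ^ (n + m)) x ≡ z
  ^-trans n m {x} eq eq′ = trans (^-+ n m x) (trans (cong (f ^ n) eq) eq′)

  ^-injective : (∀ {x y} → f x ≡ f y → x ≡ y) → ∀ n {x y} → (f ^ n) x ≡ (f ^ n) y → x ≡ y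
  ^-injective inj zero    eq = eq
  ^-injective inj (suc n) eq = ^-injective inj n (inj eq)

  -- Q holds at every point of the run except possibly the last.
  data Run (Q : A → Set) : A → ℕ → A → Set where
    []  : ∀ {x} → Run Q x 0 x
    _∷_ : ∀ {x n y} → Q x → Run Q (f x) n y → Run Q x (suc n) y

  module _ {Q : A → Set} where

    infixr 5 _⟫_

    _⟫_ : ∀ {x m y n z} → Run Q x m y → Run Q y n z → Run Q x (m + n) z
    []      ⟫ s = s
    (q ∷ r) ⟫ s = q ∷ (r ⟫ s)

    step∷ : ∀ {x y n z} → Q x → f x ≡ y → Run Q y n z → Run Q x (suc n) z
    step∷ q refl r = q ∷ r

    mapRun : ∀ {R : A → Set} → (∀ {x} → Q x → R x) → ∀ {x n y} → Run Q x n y → Run R x n y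
    mapRun h []      = []
    mapRun h (q ∷ r) = h q ∷ mapRun h r

    end : ∀ {x n y} → Run Q x n y → (f ^ n) x ≡ y
    end []                        = refl
    end (_∷_ {x = x} {n = n} _ r) = trans (^-sucʳ n x) (end r)

    before : ∀ {x n y} → Run Q x n y → ∀ {k} → k < n → Q ((f ^ k) x)
    before (q ∷ r) {zero}  _         = q
    before (_∷_ {x = x} q r) {suc k} (s<s k<n) = subst Q (sym (^-sucʳ k x)) (before r k<n)

fresh-before : ∀ {A : Set} {x : A} ys {zs} → Unique (ys ++ x ∷ zs) → All (x ≢_) ys
fresh-before []       _           = []
fresh-before (y ∷ ys) (y∉ys ∷ u) = (All.head (All.++⁻ʳ ys y∉ys) ∘ sym) ∷ fresh-before ys u

-- The dynamics of the queue.

module Queue {V : Set} {_~_ : V → V → Set} (_~?_ : Decidable _~_) where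

  step : List V → List V
  step []          = []
  step (c ∷ [])    = c ∷ []
  step (c ∷ x ∷ q) with c ~? x
  ... | yes _ = x ∷ q ∷ʳ c
  ... | no  _ = c ∷ q ∷ʳ x

  open Iteration step public

  step-↭ : ∀ q → q ↭ step q
  step-↭ []          = ↭-refl
  step-↭ (c ∷ [])    = ↭-refl
  step-↭ (c ∷ x ∷ q) with c ~? x
  ... | yes _ = ↭-trans (↭-swap c x ↭-refl) (prep x (∷↭∷ʳ c q))
  ... | no  _ = prep c (∷↭∷ʳ x q)

  ^-↭ : ∀ n q → q ↭ (step ^ n) q
  ^-↭ zero    q = ↭-refl
  ^-↭ (suc n) q = ↭-trans (^-↭ n q) (step-↭ ((step ^ n) q))

  -- An exchange and a carry-past cannot give the same result: equal heads and equal last entries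
  -- would make the two compared pairs reverses of each other, against symmetry of adjacency.
  -- Equality of lengths leaves only inputs of the same form to compare.
  step-injective : Symmetric _~_ → ∀ {p q} → step p ≡ step q → p ≡ q
  step-injective ~-sym {p} {q} eq =
    injective p q (trans (↭-length (step-↭ p)) (trans (cong length eq) (sym (↭-length (step-↭ q))))) eq
    where
    injective : ∀ p q → length p ≡ length q → step p ≡ step q → p ≡ q
    injective []          []          _ _  = refl
    injective (c ∷ [])    (d ∷ [])    _ eq = eq
    injective (c ∷ x ∷ p) (d ∷ y ∷ q) _ eq with c ~? x | d ~? y
    ... | yes _   | yes _
      with refl , eq′ ← ∷-injective eq with refl , refl ← ∷ʳ-injective p q eq′ = refl
    ... | no  _   | no  _
      with refl , eq′ ← ∷-injective eq with refl , refl ← ∷ʳ-injective p q eq′ = refl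
    ... | yes c~x | no  d≁y
      with refl , eq′ ← ∷-injective eq with refl , refl ← ∷ʳ-injective p q eq′ =
      contradiction (~-sym c~x) d≁y
    ... | no  c≁x | yes d~y
      with refl , eq′ ← ∷-injective eq with refl , refl ← ∷ʳ-injective p q eq′ =
      contradiction (~-sym d~y) c≁x

  -- A stretch of time during which the carried vertex belongs to one clique, ι U,
  -- with bridge vertex ι a; κ b is the bridge vertex of the other clique, κ W.
  module Phase
    {U W : Set} (_≟_ : DecidableEquality U) (ι : U → V) (κ : W → V) (a : U) (b : W)
    (classify : V → U ⊎ W)
    (classify-ι : ∀ u → classify (ι u) ≡ inj₁ u)
    (sound : ∀ v → [ ι , κ ]′ (classify v) ≡ v)
    (clique : ∀ u v → u ≢ v → ι u ~ ι v)
    (ι≢κ : ∀ {u w} → ι u ≢ κ w)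
    (κ-injective : ∀ {w z} → κ w ≡ κ z → w ≡ z)
    (cross : ∀ {u w} → ι u ~ κ w → u ≡ a × w ≡ b)
    where

    open DecMembership _≟_ using (_∈?_)

    data Quiet : List V → Set where
      quiet : ∀ {c x q} → ¬ (c ≡ a × x ≡ κ b) → Quiet (ι c ∷ x ∷ q)

    -- For c ≡ u both cases of a step give the same queue.
    step-ι : ∀ c u q → step (ι c ∷ ι u ∷ q) ≡ ι u ∷ q ∷ʳ ι c
    step-ι c u q with ι c ~? ι u
    ... | yes _  = refl
    ... | no  c≁u with c ≟ u
    ...   | yes refl = refl
    ...   | no  c≢u  = contradiction (clique c u c≢u) c≁u

    step-κ : ∀ {c w} q → ¬ (c ≡ a × w ≡ b) → step (ι c ∷ κ w ∷ q) ≡ ι c ∷ q ∷ʳ κ w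
    step-κ {c} {w} q ≢ab with ι c ~? κ w
    ... | yes c~w = contradiction (cross c~w) ≢ab
    ... | no  _   = refl

    -- Turning one clique round by round against a fixed pattern of the other.

    fill : List (Maybe W) → List U → List V
    fill []            _        = []
    fill (just w  ∷ t) us       = κ w ∷ fill t us
    fill (nothing ∷ t) []       = fill t []  -- junk: more holes than vertices
    fill (nothing ∷ t) (u ∷ us) = ι u ∷ fill t us

    holes : List (Maybe W) → ℕ
    holes []            = 0
    holes (just _  ∷ t) = holes t
    holes (nothing ∷ t) = suc (holes t)

    -- Here `t` is the pattern of the other clique, with `nothing` at the places held by the carried
    -- clique. Each `κ w` goes to the back as it is; at each hole the carried vertex is dropped and
    -- the one found there is taken up. So the pattern reappears behind `ys`, while the carried
    -- vertex followed by the contents of the holes turns by one place.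
    pass : ∀ t {c us us′ c′} ys → c ∷ us ≡ us′ ∷ʳ c′ → length us ≡ holes t → All (just b ≢_) t →
           Run Quiet (ι c ∷ fill t us ++ ys) (length t) (ι c′ ∷ ys ++ fill t us′)
    pass [] {c} {[]} {us′} {c′} ys eq _ [] with refl , refl ← ∷ʳ-injective [] us′ eq =
      subst (Run Quiet (ι c ∷ ys) 0) (cong (ι c ∷_) (sym (++-identityʳ ys))) []
    pass (just w ∷ t) {c} {us} {us′} {c′} ys eq h (b≢w ∷ b∉t) =
      step∷ (quiet (λ (_ , κw≡κb) → b≢w (cong just (sym (κ-injective κw≡κb)))))
        (trans (step-κ (fill t us ++ ys) (λ (_ , w≡b) → b≢w (cong just (sym w≡b))))
               (cong (ι c ∷_) (++-assoc (fill t us) ys [ κ w ])))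
        (subst (Run Quiet _ (length t)) (cong (ι c′ ∷_) (++-assoc ys [ κ w ] (fill t us′)))
          (pass t (ys ∷ʳ κ w) eq h b∉t))
    pass (nothing ∷ t) {us = u ∷ us} {[]} ys () h (_ ∷ b∉t)
    pass (nothing ∷ t) {c} {u ∷ us} {d ∷ us′} {c′} ys eq h (_ ∷ b∉t) with refl , eq′ ← ∷-injective eq =
      step∷ (quiet (λ (_ , ιu≡κb) → ι≢κ ιu≡κb))
        (trans (step-ι c u (fill t us ++ ys)) (cong (ι u ∷_) (++-assoc (fill t us) ys [ ι c ])))
        (subst (Run Quiet _ (length t)) (cong (ι c′ ∷_) (++-assoc ys [ ι c ] (fill t us′)))
          (pass t (ys ∷ʳ ι c) eq′ (suc-injective h) b∉t))

    -- The checkpoint of a round: `κ b` marks where the circle of waiting vertices is cut. The value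
    -- at `[]` is a default; it allows a rotation to be written `zs ++ c ∷ as` without splitting off
    -- its head.
    frame : List (Maybe W) → List U → List V
    frame t []       = []
    frame t (c ∷ us) = ι c ∷ κ b ∷ fill t us

    module _ (t : List (Maybe W)) (b∉t : All (just b ≢_) t) where

      -- A carried vertex other than `a` is not adjacent to `κ b`, so the first step sends `κ b` to
      -- the back; the pass over `t` then makes it second again.
      round : ∀ {c us us′ c′} → c ∷ us ≡ us′ ∷ʳ c′ → length us ≡ holes t → a ≢ c →
              Run Quiet (frame t (c ∷ us)) (suc (length t)) (frame t (c′ ∷ us′))
      round {us = us} eq h a≢c =
        step∷ (quiet (a≢c ∘ sym ∘ proj₁)) (step-κ (fill t us) (a≢c ∘ sym ∘ proj₁))
          (pass t [ κ b ] eq h b∉t)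

      -- One round per element of zs brings zs to the front; the carried vertices on
      -- the way are c and then zs from its last element down to its second.
      rounds : ∀ zs {c as} → length (as ++ zs) ≡ holes t → All (a ≢_) (drop 1 zs) → a ≢ c →
               Run Quiet (frame t (c ∷ as ++ zs)) (length zs * suc (length t)) (frame t (zs ++ c ∷ as))
      rounds [] {c} {as} _ _ _ =
        subst (λ l → Run Quiet (frame t (c ∷ l)) 0 (frame t (c ∷ as))) (sym (++-identityʳ as)) []
      rounds (z ∷ zs) {c} {as} h a∉zs a≢c =
        -- Count `z` with `as` and bring the shorter `zs` forward first; `z` is then at the very
        -- end, and one more round moves it to the front. That round carries the head of `zs`, or
        -- `c` if `zs` is empty.
        subst (λ n → Run Quiet (frame t (c ∷ as ++ z ∷ zs)) n (frame t (z ∷ zs ++ c ∷ as)))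
          (+-comm (length zs * suc (length t)) (suc (length t)))
          (subst (λ l → Run Quiet (frame t (c ∷ l)) (length zs * suc (length t))
                                  (frame t (zs ++ c ∷ as ∷ʳ z)))
             (++-assoc as [ z ] zs)
             (rounds zs {c} {as ∷ʳ z} h′ (All.drop⁺ 1 a∉zs) a≢c)
           ⟫ last zs a∉zs (trans (length-comm zs (as ∷ʳ z)) h′))
        where
        h′ : length (as ∷ʳ z ++ zs) ≡ holes t
        h′ = trans (cong length (++-assoc as [ z ] zs)) h

        length-comm : ∀ (xs ys : List U) → length (xs ++ ys) ≡ length (ys ++ xs)
        length-comm xs ys =
          trans (length-++ xs) (trans (+-comm (length xs) (length ys)) (sym (length-++ ys)))

        last : ∀ zs → All (a ≢_) zs → length (zs ++ as ∷ʳ z) ≡ holes t →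
               Run Quiet (frame t (zs ++ c ∷ as ∷ʳ z)) (suc (length t)) (frame t (z ∷ zs ++ c ∷ as))
        last []       _           h = round refl h a≢c
        last (y ∷ ys) (a≢y ∷ _) h =
          round (sym (++-assoc (y ∷ ys) (c ∷ as) [ z ])) (trans (length-insert ys) h) a≢y
          where
          length-insert : ∀ ys → length (ys ++ c ∷ as ∷ʳ z) ≡ suc (length (ys ++ as ∷ʳ z))
          length-insert []       = refl
          length-insert (_ ∷ ys) = cong suc (length-insert ys)

      -- At the start `κ b` is already at the back, so the first round lacks its opening step; the
      -- preceding meeting step makes up for it in the total. If `us` is `us₀ ∷ʳ z`, this shortened
      -- round leaves `z` carried and `a` in the first hole, and the rounds for `a ∷ us₀` complete
      -- the turn.
      revolution : ∀ us → length us ≡ holes t → All (a ≢_) us →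
                   Run Quiet (ι a ∷ fill t us ∷ʳ κ b) (length t + length us * suc (length t))
                             (frame t (a ∷ us))
      revolution us h a∉us with initLast us
      ... | [] = pass t {us′ = []} [ κ b ] refl h b∉t ⟫ []
      ... | us₀ ∷ʳ′ z =
        pass t {us′ = a ∷ us₀} {z} [ κ b ] refl h b∉t
        ⟫ subst (λ n → Run Quiet (frame t (z ∷ a ∷ us₀)) (n * suc (length t))
                                 (frame t (a ∷ us₀ ∷ʳ z)))
            (sym (length-∷ʳ us₀))
            (rounds (a ∷ us₀) {z} {[]} (trans (sym (length-∷ʳ us₀)) h)
              (proj₁ (All.∷ʳ⁻ a∉us)) (proj₂ (All.∷ʳ⁻ a∉us)))
        where
        length-∷ʳ : ∀ xs → length (xs ∷ʳ z) ≡ suc (length xs)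
        length-∷ʳ xs = trans (length-++ xs) (+-comm (length xs) 1)

    -- Splitting a queue into the carried clique and the pattern of the other.

    own : List V → List U
    own = mapMaybe (isInj₁ ∘ classify)

    shape : List V → List (Maybe W)
    shape = map (isInj₂ ∘ classify)

    fill-shape : ∀ xs → fill (shape xs) (own xs) ≡ xs
    fill-shape []       = refl
    fill-shape (x ∷ xs) with classify x | sound x
    ... | inj₁ u | refl = cong (ι u ∷_) (fill-shape xs)
    ... | inj₂ w | refl = cong (κ w ∷_) (fill-shape xs)

    length-own : ∀ xs → length (own xs) ≡ holes (shape xs)
    length-own []       = refl
    length-own (x ∷ xs) with classify x
    ... | inj₁ u = cong suc (length-own xs)
    ... | inj₂ w = length-own xs

    own-fresh : ∀ {u} xs → All (ι u ≢_) xs → All (u ≢_) (own xs)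
    own-fresh []       _            = []
    own-fresh (x ∷ xs) (u≢x ∷ u∉xs) with classify x | sound x
    ... | inj₁ v | refl = (u≢x ∘ cong ι) ∷ own-fresh xs u∉xs
    ... | inj₂ _ | refl = own-fresh xs u∉xs

    shape-fresh : ∀ {w} xs → All (κ w ≢_) xs → All (just w ≢_) (shape xs)
    shape-fresh []       _            = []
    shape-fresh (x ∷ xs) (w≢x ∷ w∉xs) with classify x | sound x
    ... | inj₁ _ | refl = (λ ()) ∷ shape-fresh xs w∉xs
    ... | inj₂ v | refl = (λ { refl → w≢x refl }) ∷ shape-fresh xs w∉xs

    own-∈ : ∀ {u} xs → ι u ∈ xs → u ∈ own xs
    own-∈ {u} (x ∷ xs) (here refl) rewrite classify-ι u = here refl
    own-∈     (x ∷ xs) (there u∈xs) with classify x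
    ... | inj₁ _ = there (own-∈ xs u∈xs)
    ... | inj₂ _ = own-∈ xs u∈xs

    -- The last occurrence is taken because `rounds` wants `a` absent from everything behind it.
    lastOccurrence : ∀ {u us} → u ∈ us → ∃₂ λ ys zs → us ≡ ys ++ u ∷ zs × All (u ≢_) zs
    lastOccurrence {u} {v ∷ us} u∈us with u ∈? us | u∈us
    ... | yes u∈us | _ with ys , zs , refl , u∉zs ← lastOccurrence u∈us = v ∷ ys , zs , refl , u∉zs
    ... | no  u∉us | here refl  = [] , us , refl , All.¬Any⇒All¬ us u∉us
    ... | no  u∉us | there u∈us = contradiction u∈us u∉us

    -- The list `xs` returns intact because its pattern never changes and the carried clique makes
    -- one full turn. With the meeting step before it, a phase costs `suc (length (own xs))` rounds
    -- of `suc (length xs)` steps.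
    phase : ∀ xs → All (ι a ≢_) xs → All (κ b ≢_) xs →
            Run Quiet (ι a ∷ xs ∷ʳ κ b) (length xs + length (own xs) * suc (length xs))
                      (ι a ∷ κ b ∷ xs)
    phase xs a∉xs b∉xs =
      subst₂ (λ n l → Run Quiet (ι a ∷ l ∷ʳ κ b) (n + length (own xs) * suc n) (ι a ∷ κ b ∷ l))
        (length-map _ xs) (fill-shape xs)
        (revolution (shape xs) (shape-fresh xs b∉xs) (own xs) (length-own xs) (own-fresh xs a∉xs))

    -- At every checkpoint `κ b` is second, so it suffices to turn the carried clique until `a`
    -- comes to the front.
    gather : ∀ {c} xs → All (κ b ≢_) xs → ι a ∈ ι c ∷ κ b ∷ xs →
             ∃₂ λ n ys → (step ^ n) (ι c ∷ κ b ∷ xs) ≡ ι a ∷ κ b ∷ ys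
    gather {c} xs b∉xs a∈ with a ≟ c
    ... | yes refl = 0 , xs , refl
    ... | no  a≢c with a∈
    ...   | here ιa≡ιc         = 0 , xs , cong (_∷ κ b ∷ xs) (sym ιa≡ιc)
    ...   | there (here ιa≡κb) = contradiction ιa≡κb ι≢κ
    ...   | there (there a∈xs) with ys , zs , eq , a∉zs ← lastOccurrence (own-∈ xs a∈xs) =
      length (a ∷ zs) * suc (length (shape xs)) , fill (shape xs) (zs ++ c ∷ ys) ,
      trans (cong (λ l → (step ^ (length (a ∷ zs) * suc (length (shape xs)))) (ι c ∷ κ b ∷ l))
                  (sym (trans (cong (fill (shape xs)) (sym eq)) (fill-shape xs))))
            (end (rounds (shape xs) (shape-fresh xs b∉xs) (a ∷ zs) {c} {ys}
                    (trans (sym (cong length eq)) (length-own xs)) a∉zs a≢c))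

    snoc : ∀ c (us : List U) → ∃₂ λ us′ c′ → c ∷ us ≡ us′ ∷ʳ c′
    snoc c us with initLast us
    ... | []       = [] , c , refl
    ... | ys ∷ʳ′ y = c ∷ ys , y , refl

    -- One pass over everything ahead of `κ b` brings it next to the carried vertex, the form from
    -- which rounds can start.
    approach : ∀ {c} xs ys → All (κ b ≢_) xs →
               ∃₂ λ n c′ → ∃[ zs ] (step ^ n) (ι c ∷ xs ++ κ b ∷ ys) ≡ ι c′ ∷ κ b ∷ zs
    approach {c} xs ys b∉xs with us , c′ , eq ← snoc c (own xs) =
      length (shape xs) , c′ , ys ++ fill (shape xs) us ,
      trans (cong (λ l → (step ^ length (shape xs)) (ι c ∷ l ++ κ b ∷ ys)) (sym (fill-shape xs)))
        (end (pass (shape xs) {c} {own xs} (κ b ∷ ys) eq (length-own xs) (shape-fresh xs b∉xs)))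

    -- First `κ b` is brought up, then `a`. Steps permute the queue, which carries uniqueness and
    -- membership of `ι a` across the first stage.
    meet : ∀ {c} q → Unique (ι c ∷ q) → ι a ∈ ι c ∷ q → κ b ∈ q →
           ∃₂ λ n ys → (step ^ n) (ι c ∷ q) ≡ ι a ∷ κ b ∷ ys
    meet {c} q u a∈ b∈ with xs , ys , refl ← ∈-∃++ b∈
                       with m , c′ , zs , eq ← approach {c} xs ys (fresh-before xs (AllPairs.tail u))
                       with q↭ ← subst (ι c ∷ q ↭_) eq (^-↭ m (ι c ∷ q))
                       with _ ∷ b∉zs ∷ _ ← Unique-resp-↭ q↭ u
                       with n , ws , eq′ ← gather {c′} zs b∉zs (∈-resp-↭ q↭ a∈)
      = n + m , ws , ^-trans n m eq eq′

-- The two cliques in alternation.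

module BridgeQueue {n₁ n₂} (K₁ : Graph n₁) (K₂ : Graph n₂)
  (complete₁ : IsComplete K₁) (complete₂ : IsComplete K₂) (v₁ : Graph.V K₁) (v₂ : Graph.V K₂) where

  private
    module K₁ = Graph K₁
    module K₂ = Graph K₂

  open Queue (bridgeEdge? K₁ K₂ v₁ v₂) public

  Vertex : Set
  Vertex = K₁.V ⊎ K₂.V

  private
    refold : ∀ (v : Vertex) → [ inj₁ , inj₂ ]′ v ≡ v
    refold (inj₁ _) = refl
    refold (inj₂ _) = refl

    refold-swap : ∀ (v : Vertex) → [ inj₂ , inj₁ ]′ (swap v) ≡ v
    refold-swap (inj₁ _) = refl
    refold-swap (inj₂ _) = refl

    clique₁ : ∀ u v → u ≢ v → BridgeEdge K₁ K₂ v₁ v₂ (inj₁ u) (inj₁ v)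
    clique₁ u v u≢v = left (complete₁ u v u≢v)

    clique₂ : ∀ u v → u ≢ v → BridgeEdge K₁ K₂ v₁ v₂ (inj₂ u) (inj₂ v)
    clique₂ u v u≢v = right (complete₂ u v u≢v)

    cross₁ : ∀ {u w} → BridgeEdge K₁ K₂ v₁ v₂ (inj₁ u) (inj₂ w) → u ≡ v₁ × w ≡ v₂
    cross₁ bridge = refl , refl

    cross₂ : ∀ {u w} → BridgeEdge K₁ K₂ v₁ v₂ (inj₂ u) (inj₁ w) → u ≡ v₂ × w ≡ v₁
    cross₂ bridge′ = refl , refl

    inj₁≢inj₂ : ∀ {u w} → inj₁ u ≢ (Vertex ∋ inj₂ w)
    inj₁≢inj₂ ()

    module First = Phase {K₁.V} {K₂.V} K₁._≟_ inj₁ inj₂ v₁ v₂ id (λ _ → refl) refold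
      clique₁ inj₁≢inj₂ inj₂-injective cross₁
    module Second = Phase {K₂.V} {K₁.V} K₂._≟_ inj₂ inj₁ v₂ v₁ swap (λ _ → refl) refold-swap
      clique₂ (inj₁≢inj₂ ∘ sym) inj₁-injective cross₂

  -- Only encounters with `v₁` carried count; one with `v₂` carried lies between two of them.
  Meeting : List Vertex → Set
  Meeting q = ∃[ xs ] q ≡ inj₁ v₁ ∷ inj₂ v₂ ∷ xs

  step-meeting₁ : ∀ xs → step (inj₁ v₁ ∷ inj₂ v₂ ∷ xs) ≡ inj₂ v₂ ∷ xs ∷ʳ inj₁ v₁
  step-meeting₁ xs with bridgeEdge? K₁ K₂ v₁ v₂ (inj₁ v₁) (inj₂ v₂)
  ... | yes _ = refl
  ... | no ≁  = contradiction bridge ≁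

  step-meeting₂ : ∀ xs → step (inj₂ v₂ ∷ inj₁ v₁ ∷ xs) ≡ inj₁ v₁ ∷ xs ∷ʳ inj₂ v₂
  step-meeting₂ xs with bridgeEdge? K₁ K₂ v₁ v₂ (inj₂ v₂) (inj₁ v₁)
  ... | yes _ = refl
  ... | no ≁  = contradiction bridge′ ≁

  quiet₁ : ∀ {q} → First.Quiet q → ¬ Meeting q
  quiet₁ (First.quiet ≢v) (_ , refl) = ≢v (refl , refl)

  quiet₂ : ∀ {q} → Second.Quiet q → ¬ Meeting q
  quiet₂ (Second.quiet _) (_ , ())

  length-own+own : ∀ xs → length (First.own xs) + length (Second.own xs) ≡ length xs
  length-own+own []            = refl
  length-own+own (inj₁ _ ∷ xs) = cong suc (length-own+own xs)
  length-own+own (inj₂ _ ∷ xs) =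
    trans (+-suc (length (First.own xs)) (length (Second.own xs))) (cong suc (length-own+own xs))

  -- The step in which `v₂` meets `v₁`, plus the phase of the first clique. It factors as `suc
  -- (length (First.own xs)) * suc (length xs)`, which is n₁(N - 1) for a full queue.
  half : List Vertex → ℕ
  half xs = suc (length xs + length (First.own xs) * suc (length xs))

  secondHalf : ∀ xs → Unique (inj₁ v₁ ∷ inj₂ v₂ ∷ xs) →
               Run (¬_ ∘ Meeting) (inj₂ v₂ ∷ inj₁ v₁ ∷ xs)
                   (half xs) (inj₁ v₁ ∷ inj₂ v₂ ∷ xs)
  secondHalf xs ((_ ∷ v₁∉xs) ∷ v₂∉xs ∷ _) =
    step∷ (λ ()) (step-meeting₂ xs) (mapRun quiet₁ (First.phase xs v₁∉xs v₂∉xs))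

  -- The run starts one step after the meeting, since the meeting itself would violate its property;
  -- hence `suc m` is the first return time. The second clique moves first, then the first, and each
  -- leaves `xs` as it was.
  recurrence : ∀ xs → Unique (inj₁ v₁ ∷ inj₂ v₂ ∷ xs) →
               ∃[ m ] suc m ≡ (2 + length xs) * (1 + length xs) ×
                      Run (¬_ ∘ Meeting) (step (inj₁ v₁ ∷ inj₂ v₂ ∷ xs)) m (inj₁ v₁ ∷ inj₂ v₂ ∷ xs)
  recurrence xs u@((_ ∷ v₁∉xs) ∷ v₂∉xs ∷ _) = m , count ,
    subst (λ q → Run (¬_ ∘ Meeting) q m (inj₁ v₁ ∷ inj₂ v₂ ∷ xs)) (sym (step-meeting₁ xs))
      (mapRun quiet₂ (Second.phase xs v₂∉xs v₁∉xs) ⟫ secondHalf xs u)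
    where
    o₁ = length (First.own xs)
    o₂ = length (Second.own xs)
    r  = suc (length xs)
    m  = (length xs + o₂ * r) + suc (length xs + o₁ * r)

    count : suc m ≡ suc r * r
    count = begin
      -- This is `suc m` by computation: the leading `suc` of each half completes its factor `r`.
      suc o₂ * r + suc o₁ * r ≡⟨ *-distribʳ-+ r (suc o₂) (suc o₁) ⟨
      (suc o₂ + suc o₁) * r   ≡⟨ cong (_* r) (cong suc (+-suc o₂ o₁)) ⟩
      (2 + (o₂ + o₁)) * r     ≡⟨ cong (λ k → (2 + k) * r) (trans (+-comm o₂ o₁) (length-own+own xs)) ⟩
      suc r * r               ∎
      where open ≡-Reasoning

  reachMeeting : ∀ q → Unique q → inj₁ v₁ ∈ q → inj₂ v₂ ∈ q → ∃[ n ] Meeting ((step ^ n) q)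
  reachMeeting (inj₁ c ∷ q) u v₁∈ (there v₂∈) = First.meet {c} q u v₁∈ v₂∈
  reachMeeting (inj₂ c ∷ q) u (there v₁∈) v₂∈
    with n , ys , eq ← Second.meet {c} q u v₂∈ v₁∈
    with q↭ ← subst (inj₂ c ∷ q ↭_) eq (^-↭ n (inj₂ c ∷ q)) =
    -- The encounter found has `v₂` carried; one further phase, of the first clique, gives a meeting
    -- with `v₁` carried.
    half ys + n , ys ,
    ^-trans (half ys) n eq
      (end (secondHalf ys (Unique-resp-↭ (↭-trans q↭ (↭-swap (inj₂ v₂) (inj₁ v₁) ↭-refl)) u)))

-- Cyclic arithmetic of labels.

module _ (n : ℕ) .{{_ : NonZero n}} where

  %-absorbˡ : ∀ x y → (x % n + y) % n ≡ (x + y) % n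
  %-absorbˡ x y = begin
    (x % n + y) % n         ≡⟨ %-distribˡ-+ (x % n) y n ⟩
    (x % n % n + y % n) % n ≡⟨ cong (λ z → (z + y % n) % n) (m%n%n≡m%n x n) ⟩
    (x % n + y % n) % n     ≡⟨ %-distribˡ-+ x y n ⟨
    (x + y) % n             ∎
    where open ≡-Reasoning

  %-absorbʳ : ∀ x y → (x + y % n) % n ≡ (x + y) % n
  %-absorbʳ x y = trans (cong (_% n) (+-comm x (y % n))) (trans (%-absorbˡ y x) (cong (_% n) (+-comm y x)))

  +-%-cancel : ∀ {x y j} → x + y ≡ n → j < n → (x + (y + j) % n) % n ≡ j
  +-%-cancel {x} {y} {j} x+y≡n j<n = begin
    (x + (y + j) % n) % n ≡⟨ %-absorbʳ x (y + j) ⟩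
    (x + (y + j)) % n     ≡⟨ cong (_% n) (+-assoc x y j) ⟨
    (x + y + j) % n       ≡⟨ cong (λ z → (z + j) % n) x+y≡n ⟩
    (n + j) % n           ≡⟨ cong (_% n) (+-comm n j) ⟩
    (j + n) % n           ≡⟨ [m+n]%n≡m%n j n ⟩
    j % n                 ≡⟨ m<n⇒m%n≡m j<n ⟩
    j                     ∎
    where open ≡-Reasoning

offset : ∀ {n} → Fin n → ℕ → Fin n
offset {n} i k = ((toℕ i + k) mod n) {{nonZeroIndex i}}

labels : ∀ {n} → Fin n → List (Fin n)
labels {n} i = applyUpTo (offset i) n

module _ {n : ℕ} .{{_ : NonZero n}} (i : Fin n) where

  toℕ-offset : ∀ k → toℕ (offset i k) ≡ (toℕ i + k) % n
  toℕ-offset k = toℕ-fromℕ< (m%n<n (toℕ i + k) n {{nonZeroIndex i}})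

  toℕ-next : toℕ (next i) ≡ suc (toℕ i) % n
  toℕ-next = toℕ-fromℕ< (m%n<n (suc (toℕ i)) n {{nonZeroIndex i}})

module _ {n : ℕ} (i : Fin n) where

  private instance
    nonZero : NonZero n
    nonZero = nonZeroIndex i

  offset-multiple : ∀ k → offset i (k * n) ≡ i
  offset-multiple k = toℕ-injective
    (trans (toℕ-offset i (k * n)) (trans ([m+kn]%n≡m%n (toℕ i) k n) (m<n⇒m%n≡m (toℕ<n i))))

  offset-0 : offset i 0 ≡ i
  offset-0 = offset-multiple 0

  -- Adding `n ∸ toℕ i` modulo `n` undoes the shift by `i`.
  offset-injective : ∀ {j k} → j < n → k < n → offset i j ≡ offset i k → j ≡ k
  offset-injective {j} {k} j<n k<n eq = begin
    j                                     ≡⟨ +-%-cancel n n∸i+i j<n ⟨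
    (n ∸ toℕ i + (toℕ i + j) % n) % n     ≡⟨ cong (λ z → (n ∸ toℕ i + z) % n) (toℕ-offset i j) ⟨
    (n ∸ toℕ i + toℕ (offset i j)) % n    ≡⟨ cong (λ z → (n ∸ toℕ i + toℕ z) % n) eq ⟩
    (n ∸ toℕ i + toℕ (offset i k)) % n    ≡⟨ cong (λ z → (n ∸ toℕ i + z) % n) (toℕ-offset i k) ⟩
    (n ∸ toℕ i + (toℕ i + k) % n) % n     ≡⟨ +-%-cancel n n∸i+i k<n ⟩
    k                                     ∎
    where
    open ≡-Reasoning
    n∸i+i = m∸n+n≡m (<⇒≤ (toℕ<n i))

  labels-unique : Unique (labels i)
  labels-unique = applyUpTo⁺₁ (offset i) n
    (λ j<k k<n eq → <⇒≢ j<k (offset-injective (<-trans j<k k<n) k<n eq))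

  labels-complete : ∀ j → j ∈ labels i
  labels-complete j = subst (_∈ labels i) eq (∈-applyUpTo⁺ (offset i) (m%n<n (n ∸ toℕ i + toℕ j) n))
    where
    eq : offset i ((n ∸ toℕ i + toℕ j) % n) ≡ j
    eq = toℕ-injective (trans (toℕ-offset i ((n ∸ toℕ i + toℕ j) % n))
                              (+-%-cancel n (m+[n∸m]≡n (<⇒≤ (toℕ<n i))) (toℕ<n j)))

  next-offset : ∀ k → next (offset i k) ≡ offset i (suc k)
  next-offset k = toℕ-injective (begin
    toℕ (next (offset i k))      ≡⟨ toℕ-next (offset i k) ⟩
    suc (toℕ (offset i k)) % n   ≡⟨ cong (λ z → suc z % n) (toℕ-offset i k) ⟩
    suc ((toℕ i + k) % n) % n    ≡⟨ %-absorbʳ n 1 (toℕ i + k) ⟩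
    suc (toℕ i + k) % n          ≡⟨ cong (_% n) (+-suc (toℕ i) k) ⟨
    (toℕ i + suc k) % n          ≡⟨ toℕ-offset i (suc k) ⟨
    toℕ (offset i (suc k))       ∎)
    where open ≡-Reasoning

  offset-next : ∀ k → offset (next i) k ≡ offset i (suc k)
  offset-next k = toℕ-injective (begin
    toℕ (offset (next i) k)     ≡⟨ toℕ-offset (next i) k ⟩
    (toℕ (next i) + k) % n      ≡⟨ cong (λ z → (z + k) % n) (toℕ-next i) ⟩
    (suc (toℕ i) % n + k) % n   ≡⟨ %-absorbˡ n (suc (toℕ i)) k ⟩
    (suc (toℕ i) + k) % n       ≡⟨ cong (_% n) (+-suc (toℕ i) k) ⟨
    (toℕ i + suc k) % n         ≡⟨ toℕ-offset i (suc k) ⟨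
    toℕ (offset i (suc k))      ∎)
    where open ≡-Reasoning

offset-1 : ∀ {n} (i : Fin n) → offset i 1 ≡ next i
offset-1 i = trans (sym (offset-next i 0)) (offset-0 (next i))

applyUpTo-cong : ∀ {A : Set} {f g : ℕ → A} → f ≗ g → ∀ n → applyUpTo f n ≡ applyUpTo g n
applyUpTo-cong f≗g zero    = refl
applyUpTo-cong f≗g (suc n) = cong₂ _∷_ (f≗g 0) (applyUpTo-cong (f≗g ∘ suc) n)

rest : ∀ {m} → Fin (2 + m) → List (Fin (2 + m))
rest {m} i = applyUpTo (offset i ∘ (2 +_)) m

labels-≡ : ∀ {m} (i : Fin (2 + m)) → labels i ≡ i ∷ next i ∷ rest i
labels-≡ i = cong₂ (λ j k → j ∷ k ∷ rest i) (offset-0 i) (offset-1 i)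

labels-next : ∀ {m} (i : Fin (2 + m)) → labels (next i) ≡ next i ∷ rest i ∷ʳ i
labels-next {m} i = begin
  labels (next i)                              ≡⟨ applyUpTo-cong (offset-next i) (2 + m) ⟩
  applyUpTo (offset i ∘ suc) (2 + m)           ≡⟨ cong (offset i 1 ∷_) (applyUpTo-∷ʳ (offset i ∘ (2 +_)) m) ⟨
  offset i 1 ∷ rest i ∷ʳ offset i (2 + m)      ≡⟨ cong₂ (λ j k → j ∷ rest i ∷ʳ k) (offset-1 i) full-turn ⟩
  next i ∷ rest i ∷ʳ i                         ∎
  where
  open ≡-Reasoning
  full-turn : offset i (2 + m) ≡ i
  full-turn = trans (cong (offset i) (sym (+-identityʳ (2 + m)))) (offset-multiple i 1)

-- Transpositions, and the passage from states to queues.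

module _ {n : ℕ} (i j : Fin n) where

  transpose-matchˡ : Components.transpose i j i ≡ j
  transpose-matchˡ rewrite dec-true (i Fin.≟ i) refl = refl

  transpose-matchʳ : Components.transpose i j j ≡ i
  transpose-matchʳ with j Fin.≟ i
  ... | yes j≡i = j≡i
  ... | no  _   rewrite dec-true (j Fin.≟ j) refl = refl

  transpose-mismatch : ∀ {k} → i ≢ k → j ≢ k → Components.transpose i j k ≡ k
  transpose-mismatch {k} i≢k j≢k
    rewrite dec-false (k Fin.≟ i) (i≢k ∘ sym) | dec-false (k Fin.≟ j) (j≢k ∘ sym) = refl

map-≡⁻ : ∀ {A B : Set} {f g : A → B} {x} xs → map f xs ≡ map g xs → x ∈ xs → f x ≡ g x
map-≡⁻ (_ ∷ _)  eq (here refl) = proj₁ (∷-injective eq)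
map-≡⁻ (_ ∷ xs) eq (there x∈)  = map-≡⁻ xs (proj₂ (∷-injective eq)) x∈

queueOf : ∀ {n} (G : Graph n) → State G → List (Graph.V G)
queueOf G (σ , i) = map (Inverse.from σ) (labels i)

-- The first two labels are displayed on the right so that `TPro` and `step` branch on the same
-- adjacency test. Along an edge only the starting point moves; otherwise the transposition also
-- puts the carried vertex at the new starting point.
queueOf-TPro : ∀ {m} (G : Graph (2 + m)) σ i →
               queueOf G (TPro G (σ , i)) ≡
               Queue.step (Graph._~?_ G) (map (Inverse.from σ) (i ∷ next i ∷ rest i))
queueOf-TPro G σ i with Graph._~?_ G (Inverse.from σ i) (Inverse.from σ (next i))
... | yes _ = trans (cong (map (Inverse.from σ)) (labels-next i))
                    (map-++ (Inverse.from σ) (next i ∷ rest i) [ i ])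
... | no  _ = begin
  map from′ (labels (next i))                         ≡⟨ cong (map from′) (labels-next i) ⟩
  map from′ (next i ∷ rest i ∷ʳ i)                    ≡⟨ map-++ from′ (next i ∷ rest i) [ i ] ⟩
  from′ (next i) ∷ map from′ (rest i) ∷ʳ from′ i      ≡⟨ cong₂ (λ v q → v ∷ q ∷ʳ from′ i) from′-next from′-rest ⟩
  from i ∷ map from (rest i) ∷ʳ from′ i               ≡⟨ cong (λ v → from i ∷ map from (rest i) ∷ʳ v) from′-i ⟩
  from i ∷ map from (rest i) ∷ʳ from (next i)         ∎
  where
  open ≡-Reasoning
  from = Inverse.from σ
  -- The inverse of `transpose i (next i)` is the transposition with its arguments exchanged.
  from′ = from ∘ Components.transpose (next i) i

  from′-next : from′ (next i) ≡ from i
  from′-next = cong from (transpose-matchˡ (next i) i)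

  from′-i : from′ i ≡ from (next i)
  from′-i = cong from (transpose-matchʳ (next i) i)

  from′-rest : map from′ (rest i) ≡ map from (rest i)
  -- The transposition fixes the remaining labels, as `labels i` has no repetitions.
  from′-rest with (_ ∷ i∉) ∷ next-i∉ ∷ _ ← subst Unique (labels-≡ i) (labels-unique i) =
    map-cong-local (All.zipWith
      (λ (≢next , ≢i) → cong from (transpose-mismatch (next i) i ≢next ≢i)) (next-i∉ , i∉))

module QueueOfState {n} (G : Graph n) where

  open Graph G using (V; _~?_)
  open Queue _~?_
  private
    module Orbit = Iteration (TPro G)

  queue : State G → List V
  queue = queueOf G

  length-queue : ∀ s → length (queue s) ≡ n
  length-queue (σ , i) = trans (length-map (Inverse.from σ) (labels i)) (length-applyUpTo (offset i) n)

  queue-unique : ∀ s → Unique (queue s)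
  queue-unique (σ , i) = map⁺ (Injection.injective (↔⇒↣ (↔-sym σ))) (labels-unique i)

  queue-complete : ∀ s v → v ∈ queue s
  queue-complete (σ , i) v = subst (_∈ queue (σ , i)) (Inverse.strictlyInverseʳ σ v)
    (∈-map⁺ (Inverse.from σ) (labels-complete i (Inverse.to σ v)))

  ≈⇒queue≡ : ∀ {s t} → _≈ₛ_ G s t → queue s ≡ queue t
  ≈⇒queue≡ {σ , i} {τ , .i} (σ≗τ , refl) = map-cong from≗ (labels i)
    where
    from≗ : Inverse.from σ ≗ Inverse.from τ
    from≗ k = begin
      Inverse.from σ k                                     ≡⟨ cong (Inverse.from σ) (Inverse.strictlyInverseˡ τ k) ⟨
      Inverse.from σ (Inverse.to τ (Inverse.from τ k))     ≡⟨ cong (Inverse.from σ) (σ≗τ (Inverse.from τ k)) ⟨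
      Inverse.from σ (Inverse.to σ (Inverse.from τ k))     ≡⟨ Inverse.strictlyInverseʳ σ (Inverse.from τ k) ⟩
      Inverse.from τ k                                     ∎
      where open ≡-Reasoning

  -- Once the index is known, the queue gives the vertex at every label, hence the inverse labeling.
  queue≡⇒≈ : ∀ {s t} → queue s ≡ queue t → proj₂ s ≡ proj₂ t → _≈ₛ_ G s t
  queue≡⇒≈ {σ , i} {τ , .i} eq refl = to≗ , refl
    where
    from≗ : Inverse.from σ ≗ Inverse.from τ
    from≗ k = map-≡⁻ (labels i) eq (labels-complete i k)

    to≗ : Inverse.to σ ≗ Inverse.to τ
    to≗ v = begin
      Inverse.to σ v                                       ≡⟨ cong (Inverse.to σ) (Inverse.strictlyInverseʳ τ v) ⟨
      Inverse.to σ (Inverse.from τ (Inverse.to τ v))       ≡⟨ cong (Inverse.to σ) (from≗ (Inverse.to τ v)) ⟨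
      Inverse.to σ (Inverse.from σ (Inverse.to τ v))       ≡⟨ Inverse.strictlyInverseˡ σ (Inverse.to τ v) ⟩
      Inverse.to τ v                                       ∎
      where open ≡-Reasoning

  index-TPro : ∀ s → proj₂ (TPro G s) ≡ next (proj₂ s)
  index-TPro (σ , i) with Inverse.from σ i ~? Inverse.from σ (next i)
  ... | yes _ = refl
  ... | no  _ = refl

  index-TPro^ : ∀ k s → proj₂ ((TPro G Orbit.^ k) s) ≡ offset (proj₂ s) k
  index-TPro^ zero    s = sym (offset-0 (proj₂ s))
  index-TPro^ (suc k) s = begin
    proj₂ (TPro G ((TPro G Orbit.^ k) s))    ≡⟨ index-TPro ((TPro G Orbit.^ k) s) ⟩
    next (proj₂ ((TPro G Orbit.^ k) s))      ≡⟨ cong next (index-TPro^ k s) ⟩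
    next (offset (proj₂ s) k)                ≡⟨ next-offset (proj₂ s) k ⟩
    offset (proj₂ s) (suc k)                 ∎
    where open ≡-Reasoning

  queue-TPro : 2 ≤ n → ∀ s → queue (TPro G s) ≡ step (queue s)
  queue-TPro (s≤s (s≤s _)) (σ , i) =
    trans (queueOf-TPro G σ i) (cong (step ∘ map (Inverse.from σ)) (sym (labels-≡ i)))

  queue-TPro^ : 2 ≤ n → ∀ k s → queue ((TPro G Orbit.^ k) s) ≡ (step ^ k) (queue s)
  queue-TPro^ 2≤n zero    s = refl
  queue-TPro^ 2≤n (suc k) s =
    trans (queue-TPro 2≤n ((TPro G Orbit.^ k) s)) (cong step (queue-TPro^ 2≤n k s))

-- Orbit lengths on the bridge sum.

module BridgeOrbits {n₁ n₂} (1≤n₁ : 1 ≤ n₁) (1≤n₂ : 1 ≤ n₂) (K₁ : Graph n₁) (K₂ : Graph n₂)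
  (complete₁ : IsComplete K₁) (complete₂ : IsComplete K₂) (v₁ : Graph.V K₁) (v₂ : Graph.V K₂) where

  private
    G = bridgeSum K₁ K₂ v₁ v₂
    N = n₁ + n₂
    module Orbit = Iteration (TPro G)
  open BridgeQueue K₁ K₂ complete₁ complete₂ v₁ v₂
  open QueueOfState G

  2≤N : 2 ≤ N
  2≤N = +-mono-≤ 1≤n₁ 1≤n₂

  -- The meeting is a rearrangement of `queue s`, so `2 + length xs` is `N`.
  meetingSize : ∀ s {r xs} → (step ^ r) (queue s) ≡ inj₁ v₁ ∷ inj₂ v₂ ∷ xs →
                (2 + length xs) * (1 + length xs) ≡ N * (N ∸ 1)
  meetingSize s {r} eq = cong (λ k → k * (k ∸ 1))
    (trans (trans (cong length (sym eq)) (sym (↭-length (^-↭ r (queue s))))) (length-queue s))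

  -- The queue forgets the index, which advances by one per step; it returns because `k` is a
  -- multiple of `N`.
  returns : ∀ s k → (step ^ k) (queue s) ≡ queue s → k ≡ N * (N ∸ 1) → Returns G s k
  returns s k eq refl = queue≡⇒≈ {(TPro G Orbit.^ k) s} {s} (trans (queue-TPro^ 2≤N k s) eq)
    (trans (index-TPro^ k s)
      (trans (cong (offset (proj₂ s)) (*-comm N (N ∸ 1))) (offset-multiple (proj₂ s) (N ∸ 1))))

  orbitHasLength : ∀ s → OrbitHasLength G s (N * (N ∸ 1))
  orbitHasLength s
    with r , xs , meets ← reachMeeting (queue s) (queue-unique s)
                            (queue-complete s (inj₁ v₁)) (queue-complete s (inj₂ v₂))
    with m , period , run ← recurrence xs
           (Unique-resp-↭ (subst (queue s ↭_) meets (^-↭ r (queue s))) (queue-unique s))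
    = subst (OrbitHasLength G s) size ((s≤s z≤n , returns s (suc m) queue-returns size) , least)
    where
    open ≡-Reasoning
    meeting = inj₁ v₁ ∷ inj₂ v₂ ∷ xs

    size : suc m ≡ N * (N ∸ 1)
    size = trans period (meetingSize s {r} meets)

    queue-returns : (step ^ suc m) (queue s) ≡ queue s
    -- The meeting `r` steps ahead recurs after `suc m` steps; injectivity cancels those `r` steps.
    queue-returns = ^-injective (step-injective (Graph.~-sym G)) r (begin
      (step ^ r) ((step ^ suc m) (queue s)) ≡⟨ ^-comm r (suc m) (queue s) ⟩
      (step ^ suc m) ((step ^ r) (queue s)) ≡⟨ cong (step ^ suc m) meets ⟩
      (step ^ suc m) meeting                ≡⟨ ^-sucʳ m meeting ⟩
      (step ^ m) (step meeting)             ≡⟨ end run ⟩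
      meeting                               ≡⟨ meets ⟨
      (step ^ r) (queue s)                  ∎)

    meeting-returns : ∀ k → Returns G s k → (step ^ k) meeting ≡ meeting
    meeting-returns k ret = begin
      (step ^ k) meeting                ≡⟨ cong (step ^ k) meets ⟨
      (step ^ k) ((step ^ r) (queue s)) ≡⟨ ^-comm k r (queue s) ⟩
      (step ^ r) ((step ^ k) (queue s)) ≡⟨ cong (step ^ r) (trans (sym (queue-TPro^ 2≤N k s))
                                             (≈⇒queue≡ {(TPro G Orbit.^ k) s} {s} ret)) ⟩
      (step ^ r) (queue s)              ≡⟨ meets ⟩
      meeting                           ∎

    least : ∀ k → 1 ≤ k → Returns G s k → suc m ≤ k
    -- A return of `s` after `suc k` steps is also a return of the meeting; if it came early, it
    -- would be a meeting after `k` steps of the run, before its end.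
    least (suc k) _ ret = ≮⇒≥ λ { (s<s k<m) →
      before run k<m (xs , trans (sym (^-sucʳ k meeting)) (meeting-returns (suc k) ret)) }

theorem7 : (n₁ n₂ : ℕ) → 1 ≤ n₁ → 1 ≤ n₂ →
    (K₁ : Graph n₁) (K₂ : Graph n₂) → IsComplete K₁ → IsComplete K₂ →
    (v₁ : Graph.V K₁) (v₂ : Graph.V K₂) (s : State (bridgeSum K₁ K₂ v₁ v₂)) →
    OrbitHasLength (bridgeSum K₁ K₂ v₁ v₂) s ((n₁ + n₂) * (n₁ + n₂ ∸ 1))
theorem7 _ _ 1≤n₁ 1≤n₂ K₁ K₂ complete₁ complete₂ v₁ v₂ =
  BridgeOrbits.orbitHasLength 1≤n₁ 1≤n₂ K₁ K₂ complete₁ complete₂ v₁ v₂
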